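{- Let $N\ge 2$ be an integer. There is no integer $C$ such that for every integer $n\ge 0$ there exists an integer index $j\ge 0$ (depending on $n$ and $N$) with $$\sum_{i=0}^{2N} F(n+i) = C\cdot F(j).$$
   Context: The Fibonacci numbers are defined by $F(0)=0$, $F(1)=1$, $F(n)=F(n-1)+F(n-2)$ for $n\ge 2$. -}

module Defs where

open import Data.Nat using (ℕ; zero; suc; _+_)

F : ℕ → ℕ
F zero          = 0
F (suc zero)    = 1
F (suc (suc n)) = F (suc n) + F n

{-# OPTIONS --safe #-}
-- The sum telescopes to F(n+2N+2) − F(n+1). Taking n = 0 and n = 1, |C| divides
-- F(2N+2) − 1 and F(2N+3) − 1, hence F(2N+1); Cassini's identity
-- F(2N+2) F(2N) + 1 = F(2N+1)² then reads 1 + 1 ≡ 0 modulo C, so |C| ≤ 2. But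
-- for N ≥ 2, F(2N+2) − 1 lies strictly between F(2N+1) and F(2N+2), and strictly
-- between 2F(2N) and 2F(2N+1), so already the case n = 0 fails.
module Submission where

open import Defs
open import Data.Nat using (ℕ; zero; suc; _+_; _*_; _∸_; _≤_; _<_; z≤n; s≤s)
open import Data.Nat.Properties
open import Data.Nat.Divisibility using (_∣_; ∣⇒≤; m∣m*n; ∣m⇒∣m*n; ∣m∣n⇒∣m+n; ∣m+n∣m⇒∣n)
open import Data.Nat.ListAction using (sum)
open import Data.Nat.Tactic.RingSolver using (solve-∀)
open import Data.Integer using (ℤ; +_; ∣_∣) renaming (_*_ to _*ℤ_)
open import Data.Integer.Properties using (abs-*)
open import Data.List using (map; upTo; applyUpTo)
open import Data.List.Properties using (map-upTo)
open import Data.Product using (Σ-syntax; _,_; proj₁; proj₂)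
open import Data.Sum using (inj₁; inj₂)
open import Function using (_∘_)
open import Relation.Nullary using (¬_)
open import Relation.Binary.PropositionalEquality using (_≡_; _≢_; refl; sym; trans; cong; subst; module ≡-Reasoning)

-- Induction on `m` with `f` varying: `f 0 + f 1` merges into `f 2`, and the remaining sum is that
-- of the shift `f ∘ suc`, which satisfies the same recurrence.
sum-applyUpTo-recurrence : (f : ℕ → ℕ) → (∀ i → f (2 + i) ≡ f (1 + i) + f i) →
  ∀ m → sum (applyUpTo f m) + f 1 ≡ f (suc m)
sum-applyUpTo-recurrence f rec zero    = refl
sum-applyUpTo-recurrence f rec (suc m) = begin
  f 0 + s + f 1    ≡⟨ swap (f 0) s (f 1) ⟩
  s + (f 1 + f 0)  ≡⟨ cong (λ t → s + t) (rec 0) ⟨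
  s + f 2          ≡⟨ sum-applyUpTo-recurrence (f ∘ suc) (rec ∘ suc) m ⟩
  f (2 + m)        ∎
  where
  open ≡-Reasoning
  s = sum (applyUpTo (f ∘ suc) m)
  swap : ∀ x y z → x + y + z ≡ y + (z + x)
  swap = solve-∀

sum-upTo-recurrence : (f : ℕ → ℕ) → (∀ i → f (2 + i) ≡ f (1 + i) + f i) →
  ∀ m → sum (map f (upTo m)) + f 1 ≡ f (suc m)
sum-upTo-recurrence f rec m =
  trans (cong (λ l → sum l + f 1) (map-upTo f m)) (sum-applyUpTo-recurrence f rec m)

-- Even indices fix the sign in Cassini's identity, so it can be stated without subtraction. Passing
-- from `n` to `suc n` adds `x * x + 4 * (x * y) + 3 * (y * y)` to both sides.
cassini-even : ∀ n → F (suc (2 * n)) * F (suc (2 * n)) ≡ F (2 + 2 * n) * F (2 * n) + 1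
cassini-even zero = refl
cassini-even (suc n) = subst (λ d → F (suc d) * F (suc d) ≡ F (2 + d) * F d + 1) (sym (*-suc 2 n)) (begin
  (y + x + y) * (y + x + y)                                   ≡⟨ expand x y ⟩
  y * y + (x * x + 4 * (x * y) + 3 * (y * y))                 ≡⟨ cong (_+ (x * x + 4 * (x * y) + 3 * (y * y))) (cassini-even n) ⟩
  (y + x) * x + 1 + (x * x + 4 * (x * y) + 3 * (y * y))       ≡⟨ collect x y ⟩
  (y + x + y + (y + x)) * (y + x) + 1                         ∎)
  where
  open ≡-Reasoning
  x = F (2 * n)
  y = F (suc (2 * n))
  expand : ∀ x y → (y + x + y) * (y + x + y) ≡ y * y + (x * x + 4 * (x * y) + 3 * (y * y))
  expand = solve-∀
  collect : ∀ x y → (y + x) * x + 1 + (x * x + 4 * (x * y) + 3 * (y * y)) ≡ (y + x + y + (y + x)) * (y + x) + 1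
  collect = solve-∀

-- Modulo `c`, the difference of `b` and `a` gives y ≡ 0, and then `a + 1 ≡ y + x` gives x ≡ 1; the
-- Cassini hypothesis becomes 0 ≡ 1 + 1.
∣2-of-cassini : ∀ {c x y a b} → c ∣ a → c ∣ b → a + 1 ≡ y + x → b + 1 ≡ y + x + y →
  y * y ≡ (y + x) * x + 1 → c ∣ 2
∣2-of-cassini {c} {x} {y} {a} {b} c∣a c∣b a+1≡ b+1≡ cas =
  ∣m+n∣m⇒∣n (subst (c ∣_) y²+y≡ (∣m∣n⇒∣m+n (∣m⇒∣m*n y c∣y) c∣y))
            (∣m∣n⇒∣m+n c∣a (∣m⇒∣m*n x c∣a))
  where
  open ≡-Reasoning
  shift : ∀ a y → a + 1 + y ≡ a + y + 1
  shift = solve-∀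
  b≡a+y : b ≡ a + y
  b≡a+y = +-cancelʳ-≡ 1 b (a + y) (trans b+1≡ (trans (cong (_+ y) (sym a+1≡)) (shift a y)))
  c∣y : c ∣ y
  c∣y = ∣m+n∣m⇒∣n (subst (c ∣_) b≡a+y c∣b) c∣a
  expand : ∀ a x y → (a + 1) * x + 1 + y ≡ y + x + (a * x + 1)
  expand = solve-∀
  collect : ∀ a x → a + 1 + (a * x + 1) ≡ a + a * x + 2
  collect = solve-∀
  y²+y≡ : y * y + y ≡ a + a * x + 2
  y²+y≡ = begin
    y * y + y              ≡⟨ cong (_+ y) cas ⟩
    (y + x) * x + 1 + y    ≡⟨ cong (λ t → t * x + 1 + y) a+1≡ ⟨
    (a + 1) * x + 1 + y    ≡⟨ expand a x y ⟩
    y + x + (a * x + 1)    ≡⟨ cong (_+ (a * x + 1)) a+1≡ ⟨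
    a + 1 + (a * x + 1)    ≡⟨ collect a x ⟩
    a + a * x + 2          ∎

F-pos : ∀ n → 1 ≤ F (suc n)
F-pos zero    = ≤-refl
F-pos (suc n) = ≤-trans (F-pos n) (m≤m+n _ _)

F-≤-suc : ∀ n → F n ≤ F (suc n)
F-≤-suc zero    = z≤n
F-≤-suc (suc n) = m≤m+n _ _

F-mono-+ : ∀ m k → F m ≤ F (k + m)
F-mono-+ m zero    = ≤-refl
F-mono-+ m (suc k) = ≤-trans (F-mono-+ m k) (F-≤-suc (k + m))

F-mono-≤ : ∀ {m n} → m ≤ n → F m ≤ F n
F-mono-≤ {m} {n} m≤n = subst (λ t → F m ≤ F t) (m∸n+n≡m m≤n) (F-mono-+ m (n ∸ m))

-- By monotonicity of `F`, every `c * F j` lies at or below `c * F i`, or at or above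
-- `c * F (suc i)`.
multiple-of-F-between : ∀ c i {v} → c * F i < v → v < c * F (suc i) → ∀ j → v ≢ c * F j
multiple-of-F-between c i lo hi j refl with ≤-<-connex j i
... | inj₁ j≤i = <⇒≱ lo (*-monoʳ-≤ c (F-mono-≤ j≤i))
... | inj₂ i<j = <⇒≱ hi (*-monoʳ-≤ c (F-mono-≤ i<j))

F-pred-not-small-multiple : ∀ d {v} → v + 1 ≡ F (6 + d) → ∀ c → c ≤ 2 → ∀ j → v ≢ c * F j
F-pred-not-small-multiple d {v} v+1≡ = go
  where
  open ≤-Reasoning
  a = F (3 + d)
  b = F (2 + d)
  1<a : 1 < a
  1<a = +-mono-≤ (F-pos (suc d)) (F-pos d)
  -- Since `v` is `F (6 + d)` minus 1, a strict lower bound on `v` needs a slack of 2.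
  lower : ∀ u → u + 2 ≤ F (6 + d) → u < v
  lower u u+2≤ = +-cancelʳ-≤ 1 (suc u) v (begin
    suc u + 1  ≡⟨ +-suc u 1 ⟨
    u + 2      ≤⟨ u+2≤ ⟩
    F (6 + d)  ≡⟨ v+1≡ ⟨
    v + 1      ∎)
  upper : ∀ u → F (6 + d) ≤ u → v < u
  upper u ≤u = ≤-trans (≤-reflexive (trans (+-comm 1 v) v+1≡)) ≤u
  doubled : ∀ a b → 2 * (a + b) + a ≡ a + b + a + (a + b)
  doubled = solve-∀
  go : ∀ c → c ≤ 2 → ∀ j → v ≢ c * F j
  go 0 _ = λ _ v≡0 → n≮0 (subst (0 <_) v≡0 (lower 0 (begin
    2          ≤⟨ 1<a ⟩
    a          ≤⟨ F-mono-+ (3 + d) 3 ⟩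
    F (6 + d)  ∎)))
  -- The slack is F(6+d) - F(5+d) = F(4+d) = a + b.
  go 1 _ = multiple-of-F-between 1 (5 + d)
    (lower (1 * F (5 + d)) (begin
      1 * F (5 + d) + 2  ≡⟨ cong (_+ 2) (*-identityˡ (F (5 + d))) ⟩
      F (5 + d) + 2      ≤⟨ +-monoʳ-≤ (F (5 + d)) (≤-trans 1<a (m≤m+n a b)) ⟩
      F (6 + d)          ∎))
    (upper (1 * F (6 + d)) (≤-reflexive (sym (*-identityˡ (F (6 + d))))))
  -- Here F(6+d) - 2F(4+d) = F(3+d) = a, which is at least 2 already for d = 0.
  go 2 _ = multiple-of-F-between 2 (4 + d)
    (lower (2 * F (4 + d)) (begin
      2 * (a + b) + 2    ≤⟨ +-monoʳ-≤ (2 * (a + b)) 1<a ⟩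
      2 * (a + b) + a    ≡⟨ doubled a b ⟩
      F (6 + d)          ∎))
    (upper (2 * F (5 + d)) (+-monoʳ-≤ (F (5 + d)) (≤-trans (F-≤-suc (4 + d)) (m≤m+n _ 0))))
  go (suc (suc (suc _))) (s≤s (s≤s ()))

theorem5p3 : (N : ℕ) → 2 ≤ N →
    ¬ (Σ[ C ∈ ℤ ] ((n : ℕ) → Σ[ j ∈ ℕ ] (+ (sum (map (λ i → F (n + i)) (upTo (suc (2 * N))))) ≡ C *ℤ (+ F j))))
theorem5p3 1 (s≤s ())
theorem5p3 N@(suc (suc k)) _ (C , sol) =
  F-pred-not-small-multiple (2 * k) (trans S₀ (cong (λ t → F (2 + t)) 2N≡4+2k))
    ∣ C ∣ (∣⇒≤ c∣2) (proj₁ (sol 0)) (S≡ 0)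
  where
  S : ℕ → ℕ
  S n = sum (map (λ i → F (n + i)) (upTo (suc (2 * N))))
  -- Absolute values turn the integer equation into one over ℕ, which settles the sign of `C`.
  S≡ : ∀ n → S n ≡ ∣ C ∣ * F (proj₁ (sol n))
  S≡ n = trans (cong ∣_∣ (proj₂ (sol n))) (abs-* C (+ F (proj₁ (sol n))))
  ∣S : ∀ n → ∣ C ∣ ∣ S n
  ∣S n = subst (∣ C ∣ ∣_) (sym (S≡ n)) (m∣m*n (F (proj₁ (sol n))))
  -- The subtracted term `f 1` is F(1) for n = 0 and F(2) for n = 1, hence 1 in both cases.
  S₀ : S 0 + 1 ≡ F (2 + 2 * N)
  S₀ = sum-upTo-recurrence F (λ _ → refl) (suc (2 * N))
  S₁ : S 1 + 1 ≡ F (3 + 2 * N)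
  S₁ = sum-upTo-recurrence (F ∘ suc) (λ _ → refl) (suc (2 * N))
  c∣2 : ∣ C ∣ ∣ 2
  c∣2 = ∣2-of-cassini {x = F (2 * N)} {y = F (suc (2 * N))} (∣S 0) (∣S 1) S₀ S₁ (cassini-even N)
  2N≡4+2k : 2 * N ≡ 4 + 2 * k
  2N≡4+2k = *-distribˡ-+ 2 2 k
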